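{- Let $\mathbf{X},\mathbf{Y}$ be quasivarieties and let $\langle\zeta,f\rangle:Tm(\mathcal{L}_{\mathbf{X}})\to Tm(\mathcal{L}_{\mathbf{Y}})$ be a sober translation. Then the assignment $\tau:\Xi(\mathbf{X})\to\Xi^f(\mathbf{Y})$, $\tau(\mathbf{K})=\{\mathcal{A}\in\mathbf{Y}:\theta(\mathcal{A})\in\mathbf{K}\}$, is a lattice isomorphism.
   Context: A quasivariety is a class of similar algebras closed under isomorphisms, subalgebras and reduced products. $\mathbf{X},\mathbf{Y}$ have languages $\mathcal{L}_{\mathbf{X}},\mathcal{L}_{\mathbf{Y}}$; $\Xi(\mathbf{K})$ is the lattice of subquasivarieties of $\mathbf{K}$. For a class $\mathbf{K}$, $\Phi\vDash_{\mathbf{K}}\lambda\approx\gamma$ means every assignment into an algebra of $\mathbf{K}$ satisfying $\Phi$ satisfies $\lambda\approx\gamma$. Selective translation: $\zeta$ assigns to each $n$-ary symbol $g\in\mathcal{L}_{\mathbf{X}}$ an $n$-ary term $\zeta(g)$ of $\mathcal{L}_{\mathbf{Y}}$; $f(x)$ is a unary term of $\mathcal{L}_{\mathbf{Y}}$ (the selector). For an infinite variable set $V$ define $\zeta_*:Tm(\mathcal{L}_{\mathbf{X}},V)\to Tm(\mathcal{L}_{\mathbf{Y}},V)$ by $\zeta_*(x)=f(x)$ on variables and $\zeta_*(g(\phi_1,\dots,\phi_n))=\zeta(g)(\zeta_*(\phi_1),\dots,\zeta_*(\phi_n))$ (in particular $\zeta_*(c)=\zeta(c)$ for constants), and $\zeta^*(\Phi)=\{\zeta_*(\delta)\approx\zeta_*(\gamma):\delta\approx\gamma\in\Phi\}$.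 $\langle\zeta,f\rangle$ is a selective translation if: (i) $\vDash_{\mathbf{Y}}f(f(x))\approx f(x)$; (ii) $\Phi\vDash_{\mathbf{X}}\lambda\approx\gamma$ implies $\zeta^*(\Phi)\cup\{f(x)\approx x:x\in V\}\vDash_{\mathbf{Y}}\zeta^*(\lambda\approx\gamma)$; (iii) for each $n$-ary $g\in\mathcal{L}_{\mathbf{X}}$, $\{f(x_i)\approx x_i:i\le n\}\vDash_{\mathbf{Y}}f(\zeta(g)(x_1,\dots,x_n))\approx\zeta(g)(x_1,\dots,x_n)$. For $\mathcal{A}\in\mathbf{Y}$, $\mathcal{A}^f=\{a\in A:f(a)=a\}$, and $\theta(\mathcal{A})\in\mathbf{X}$ is the algebra with universe $\mathcal{A}^f$ and operations $g^{\theta(\mathcal{A})}=\zeta(g)^{\mathcal{A}}$ restricted to $\mathcal{A}^f$. With restriction on homomorphisms, $\theta:\mathbf{Y}\to\mathbf{X}$ is a right adjoint functor; $\mathcal{F}:\mathbf{X}\to\mathbf{Y}$ is its left adjoint, with unit $\eta:1\Rightarrow\theta\mathcal{F}$ and counit $\varepsilon:\mathcal{F}\theta\Rightarrow1$. A selective translation is strongly selective if $\eta$ is an isomorphism, and sober if moreover $\varepsilon$ is pointwise injective and $\mathcal{F}$ preserves injective homomorphisms. For $\mathcal{A},\mathcal{B}\in\mathbf{Y}$, $\mathcal{B}\preceq_f\mathcal{A}$ means $\mathcal{B}$ is a subalgebra of $\mathcal{A}$ with $\mathcal{B}^f=\mathcal{A}^f$; for $\mathbf{K}\in\Xi(\mathbf{Y})$,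 $\mathbf{K}^\uparrow=\{\mathcal{A}\in\mathbf{Y}:\exists\mathcal{B}\in\mathbf{K},\ \mathcal{B}\preceq_f\mathcal{A}\}$; $\Xi^f(\mathbf{Y})=\{\mathbf{K}^\uparrow:\mathbf{K}\in\Xi(\mathbf{Y})\}$ is the complete lattice (under inclusion) of $\mathsf{PAt}$-$f$-quasivarieties. -}

module Defs where

open import Level using (Level; _⊔_; suc; Lift; lift; lower)
open import Data.Empty.Polymorphic using (⊥)
open import Data.Unit.Polymorphic using (⊤; tt)
open import Data.Nat using (ℕ)
open import Data.Fin using (Fin; toℕ) renaming (zero to fzero)
open import Data.Fin.Properties using (toℕ-injective)
open import Data.List using (List; []; _∷_; _++_; length; lookup; tabulate)
open import Data.List.Relation.Unary.Any using (here; there; index)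
open import Data.List.Relation.Unary.Any.Properties using (lookup-index)
open import Data.List.Membership.Propositional using (_∈_)
open import Data.List.Membership.Propositional.Properties
  using (∈-++⁺ˡ; ∈-++⁺ʳ; ∈-tabulate⁺)
open import Data.Product using (Σ; Σ-syntax; ∃; _×_; _,_; proj₁; proj₂)
open import Data.Sum using (inj₁; inj₂)
open import Function using (_∘_; id; _↣_; Injective; Bijective)
open import Function.Bundles using (module Injection)
open import Relation.Binary using (Setoid)
open import Relation.Binary.Lattice using (Lattice)
open import Relation.Binary.PropositionalEquality as ≡ using (_≡_)
open import Relation.Nullary using (Dec; yes; no; ¬_; contradiction; map′; decidable-stable)
open import Relation.Unary using (Pred; ∅; _⊆_; _≐_; _∪_; _∩_)
open import Algebra.Lattice.Bundles using (RawLattice)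
open import Axiom.ExcludedMiddle using (ExcludedMiddle)
import Algebra.Lattice.Bundles as Alg
import Relation.Binary.Lattice.Properties.Lattice as LatticeProperties

private
  variable
    ℓ v w p : Level

record Signature (ℓ : Level) : Set (suc ℓ) where
  field
    Op    : Set ℓ
    arity : Op → ℕ

open Signature public

data Term (L : Signature ℓ) (V : Set v) : Set (ℓ ⊔ v) where
  var : V → Term L V
  app : (g : Op L) → (Fin (arity L g) → Term L V) → Term L V

_[_] : {L : Signature ℓ} {V : Set v} {W : Set w} →
       Term L V → (V → Term L W) → Term L W
var x    [ σ ] = σ x
app g ts [ σ ] = app g (λ i → ts i [ σ ])

-- Universal algebra convention: the universe is non-empty.
record Algebra (L : Signature ℓ) : Set (suc ℓ) where
  field
    setoid : Setoid ℓ ℓ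
  open Setoid setoid public
  field
    op        : (g : Op L) → (Fin (arity L g) → Carrier) → Carrier
    op-cong   : ∀ g {xs ys} → (∀ i → xs i ≈ ys i) → op g xs ≈ op g ys
    inhabited : Carrier

∣_∣ : {L : Signature ℓ} → Algebra L → Set ℓ
∣ A ∣ = Algebra.Carrier A

eval : {L : Signature ℓ} {V : Set v} (A : Algebra L) → (V → ∣ A ∣) → Term L V → ∣ A ∣
eval A ρ (var x)    = ρ x
eval A ρ (app g ts) = Algebra.op A g (λ i → eval A ρ (ts i))

record Hom {L : Signature ℓ} (A B : Algebra L) : Set ℓ where
  private
    module A = Algebra A
    module B = Algebra B
  field
    to   : ∣ A ∣ → ∣ B ∣
    cong : ∀ {x y} → x A.≈ y → to x B.≈ to y
    homo : ∀ g xs → to (A.op g xs) B.≈ B.op g (to ∘ xs)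

open Hom public using (to)

module _ {L : Signature ℓ} where

  idHom : (A : Algebra L) → Hom A A
  idHom A = record { to = id ; cong = id ; homo = λ _ _ → Algebra.refl A }

  infixr 9 _∘ₕ_
  _∘ₕ_ : {A B C : Algebra L} → Hom B C → Hom A B → Hom A C
  _∘ₕ_ {C = C} k h = record
    { to   = to k ∘ to h
    ; cong = Hom.cong k ∘ Hom.cong h
    ; homo = λ g xs → Algebra.trans C (Hom.cong k (Hom.homo h g xs)) (Hom.homo k g _)
    }

  infix 4 _≗ₕ_
  _≗ₕ_ : {A B : Algebra L} → Hom A B → Hom A B → Set ℓ
  _≗ₕ_ {B = B} h k = ∀ x → Algebra._≈_ B (to h x) (to k x)

  IsInjective IsIso : {A B : Algebra L} → Hom A B → Set ℓ
  IsInjective {A} {B} h = Injective (Algebra._≈_ A) (Algebra._≈_ B) (to h)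
  IsIso       {A} {B} h = Bijective (Algebra._≈_ A) (Algebra._≈_ B) (to h)

  infix 4 _≅_
  _≅_ : Algebra L → Algebra L → Set ℓ
  A ≅ B = Σ (Hom A B) IsIso

record Subuniverse {L : Signature ℓ} (A : Algebra L) : Set (suc ℓ) where
  open Algebra A
  field
    mem      : Pred Carrier ℓ
    resp     : ∀ {x y} → x ≈ y → mem x → mem y
    closed   : ∀ g {xs} → (∀ i → mem (xs i)) → mem (op g xs)
    nonempty : ∃ mem

open Subuniverse public using (mem)

subalgebra : {L : Signature ℓ} (A : Algebra L) → Subuniverse A → Algebra L
subalgebra A S = record
  { setoid = record
    { Carrier       = Σ Carrier S.mem
    ; _≈_           = λ x y → proj₁ x ≈ proj₁ y
    ; isEquivalence = record { refl = refl ; sym = sym ; trans = trans }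
    }
  ; op        = λ g xs → op g (proj₁ ∘ xs) , S.closed g (proj₂ ∘ xs)
  ; op-cong   = λ g → op-cong g
  ; inhabited = S.nonempty
  }
  where
  open Algebra A
  module S = Subuniverse S

inclusion : {L : Signature ℓ} (A : Algebra L) (S : Subuniverse A) → Hom (subalgebra A S) A
inclusion A S = record { to = proj₁ ; cong = id ; homo = λ _ _ → Algebra.refl A }

-- The improper filter and the empty index set are allowed, so a class closed
-- under reduced products contains the one-element algebra.
record Filter (I : Set ℓ) : Set (suc ℓ) where
  field
    Large  : Pred (Pred I ℓ) ℓ
    full   : Large (λ _ → ⊤)
    upward : ∀ {P Q} → P ⊆ Q → Large P → Large Q
    meet   : ∀ {P Q} → Large P → Large Q → Large (P ∩ Q)

  always : ∀ {P} → (∀ i → P i) → Large P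
  always all = upward (λ {i} _ → all i) full

  meets : ∀ n {P : Fin n → Pred I ℓ} → (∀ k → Large (P k)) → Large (λ i → ∀ k → P k i)
  meets ℕ.zero    large = always (λ _ ())
  meets (ℕ.suc n) large =
    upward (λ { (p , ps) fzero → p ; (p , ps) (Fin.suc k) → ps k })
           (meet (large fzero) (meets n (large ∘ Fin.suc)))

reducedProduct : {L : Signature ℓ} {I : Set ℓ} → (I → Algebra L) → Filter I → Algebra L
reducedProduct {L = L} {I} A F = record
  { setoid = record
    { Carrier       = ∀ i → ∣ A i ∣
    ; _≈_           = λ a b → Large (λ i → A._≈_ i (a i) (b i))
    ; isEquivalence = record
      { refl  = always (λ i → A.refl i)
      ; sym   = upward (λ {i} → A.sym i)
      ; trans = λ p q → upward (λ {i} (x , y) → A.trans i x y) (meet p q)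
      }
    }
  ; op        = λ g xs i → A.op i g (λ k → xs k i)
  ; op-cong   = λ g eqs → upward (λ {i} → A.op-cong i g) (meets (arity L g) eqs)
  ; inhabited = λ i → A.inhabited i
  }
  where
  open Filter F
  module A i = Algebra (A i)

Class : Signature ℓ → Set (suc (suc ℓ))
Class {ℓ} L = Pred (Algebra L) (suc ℓ)

record IsQuasivariety {L : Signature ℓ} (K : Class L) : Set (suc ℓ) where
  field
    iso     : ∀ {A B} → A ≅ B → K A → K B
    sub     : ∀ {A} (S : Subuniverse A) → K A → K (subalgebra A S)
    reduced : ∀ {I : Set ℓ} {A : I → Algebra L} (F : Filter I) →
              (∀ i → K (A i)) → K (reducedProduct A F)

record Quasivariety (L : Signature ℓ) : Set (suc (suc ℓ)) where
  field
    class          : Class L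
    isQuasivariety : IsQuasivariety class
  open IsQuasivariety isQuasivariety public

open Quasivariety public using (class)

-- Quasivariety generated by K; used for joins, since unions of quasivarieties need
-- not be quasivarieties.
data Generated {L : Signature ℓ} (K : Class L) : Class L where
  gen     : ∀ {A} → K A → Generated K A
  iso     : ∀ {A B} → A ≅ B → Generated K A → Generated K B
  sub     : ∀ {A} (S : Subuniverse A) → Generated K A → Generated K (subalgebra A S)
  reduced : ∀ {I : Set ℓ} {A : I → Algebra L} (F : Filter I) →
            (∀ i → Generated K (A i)) → Generated K (reducedProduct A F)

module _ {L : Signature ℓ} {K : Class L} where

  generated-isQuasivariety : IsQuasivariety (Generated K)
  generated-isQuasivariety = record { iso = iso ; sub = sub ; reduced = reduced }

  generated-least : {M : Class L} → IsQuasivariety M → K ⊆ M → Generated K ⊆ M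
  generated-least q K⊆M (gen a)        = K⊆M a
  generated-least q K⊆M (iso i a)      = IsQuasivariety.iso q i (generated-least q K⊆M a)
  generated-least q K⊆M (sub S a)      = IsQuasivariety.sub q S (generated-least q K⊆M a)
  generated-least q K⊆M (reduced F as) =
    IsQuasivariety.reduced q F (λ i → generated-least q K⊆M (as i))

-- C is a collection of codes for classes; two codes are equal when they denote the
-- same class.
inclusionLattice : {L : Signature ℓ} {C : Set (suc (suc ℓ))} (cl : C → Class L)
                   (_∨_ _∧_ : C → C → C) →
                   (∀ K M → cl K ⊆ cl (K ∨ M) × cl M ⊆ cl (K ∨ M) ×
                      (∀ N → cl K ⊆ cl N → cl M ⊆ cl N → cl (K ∨ M) ⊆ cl N)) →
                   (∀ K M → cl (K ∧ M) ≐ (cl K ∩ cl M)) →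
                   Lattice (suc (suc ℓ)) (suc ℓ) (suc ℓ)
inclusionLattice {C = C} cl _∨_ _∧_ sup inf = record
  { Carrier   = C
  ; _≈_       = λ K M → cl K ≐ cl M
  ; _≤_       = λ K M → cl K ⊆ cl M
  ; _∨_       = _∨_
  ; _∧_       = _∧_
  ; isLattice = record
    { isPartialOrder = record
      { isPreorder = record
        { isEquivalence = record
          { refl  = id , id
          ; sym   = λ (f , g) → g , f
          ; trans = λ (f , g) (f′ , g′) → (λ a → f′ (f a)) , (λ a → g (g′ a))
          }
        ; reflexive = proj₁
        ; trans     = λ f g a → g (f a)
        }
      ; antisym = _,_
      }
    ; supremum = sup
    ; infimum  = λ K M →
        (λ a → proj₁ (proj₁ (inf K M) a)) ,
        (λ a → proj₂ (proj₁ (inf K M) a)) ,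
        λ N f g a → proj₂ (inf K M) (f a , g a)
    }
  }

record Subquasivariety {L : Signature ℓ} (X : Quasivariety L) : Set (suc (suc ℓ)) where
  field
    quasivariety : Quasivariety L
    below        : class quasivariety ⊆ class X
  open Quasivariety quasivariety public

open Subquasivariety public using () renaming (class to ⟨_⟩)

module _ {L : Signature ℓ} (X : Quasivariety L) where

  infixr 7 _∧Ξ_
  infixr 6 _∨Ξ_

  _∧Ξ_ _∨Ξ_ : Subquasivariety X → Subquasivariety X → Subquasivariety X
  K ∧Ξ M = record
    { quasivariety = record
      { class          = ⟨ K ⟩ ∩ ⟨ M ⟩
      ; isQuasivariety = record
        { iso     = λ i (a , b) → K.iso i a , M.iso i b
        ; sub     = λ S (a , b) → K.sub S a , M.sub S b
        ; reduced = λ F ab → K.reduced F (proj₁ ∘ ab) , M.reduced F (proj₂ ∘ ab)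
        }
      }
    ; below = λ (a , _) → K.below a
    }
    where
    module K = Subquasivariety K
    module M = Subquasivariety M
  K ∨Ξ M = record
    { quasivariety = record
      { class          = Generated (⟨ K ⟩ ∪ ⟨ M ⟩)
      ; isQuasivariety = generated-isQuasivariety
      }
    ; below = generated-least (Quasivariety.isQuasivariety X)
        λ { (inj₁ a) → Subquasivariety.below K a ; (inj₂ b) → Subquasivariety.below M b }
    }

  Ξ : Lattice (suc (suc ℓ)) (suc ℓ) (suc ℓ)
  Ξ = inclusionLattice ⟨_⟩ _∨Ξ_ _∧Ξ_
    (λ K M → (λ a → gen (inj₁ a)) , (λ b → gen (inj₂ b)) ,
       λ N f g → generated-least (Subquasivariety.isQuasivariety N)
         λ { (inj₁ a) → f a ; (inj₂ b) → g b })
    (λ K M → id , id)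

Equation : Signature ℓ → Set v → Set (ℓ ⊔ v)
Equation L V = Term L V × Term L V

Satisfies : {L : Signature ℓ} {V : Set v} (A : Algebra L) → (V → ∣ A ∣) → Equation L V → Set ℓ
Satisfies A ρ (s , t) = Algebra._≈_ A (eval A ρ s) (eval A ρ t)

infix 4 _⊨[_]_
_⊨[_]_ : {L : Signature ℓ} {V : Set v} →
         Pred (Equation L V) p → Class L → Equation L V → Set (suc ℓ ⊔ v ⊔ p)
_⊨[_]_ {V = V} Φ K e =
  ∀ A → K A → (ρ : V → ∣ A ∣) → (∀ {d} → Φ d → Satisfies A ρ d) → Satisfies A ρ e

module _ {L : Signature ℓ} where

  eval-cong : {V : Set v} (A : Algebra L) {ρ σ : V → ∣ A ∣} (t : Term L V) →
              (∀ x → Algebra._≈_ A (ρ x) (σ x)) →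
              Algebra._≈_ A (eval A ρ t) (eval A σ t)
  eval-cong A (var x)    eq = eq x
  eval-cong A (app g ts) eq = Algebra.op-cong A g (λ i → eval-cong A (ts i) eq)

  eval-subst : {V : Set v} {W : Set w} (A : Algebra L) {ρ : W → ∣ A ∣}
               (t : Term L V) {σ : V → Term L W} →
               Algebra._≈_ A (eval A ρ (t [ σ ])) (eval A (λ x → eval A ρ (σ x)) t)
  eval-subst A (var x)    = Algebra.refl A
  eval-subst A (app g ts) = Algebra.op-cong A g (λ i → eval-subst A (ts i))

  eval-hom : {V : Set v} {A B : Algebra L} (h : Hom A B) {ρ : V → ∣ A ∣} (t : Term L V) →
             Algebra._≈_ B (to h (eval A ρ t)) (eval B (to h ∘ ρ) t)
  eval-hom {B = B} h (var x)    = Algebra.refl B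
  eval-hom {B = B} h (app g ts) =
    Algebra.trans B (Hom.homo h g _) (Algebra.op-cong B g (λ i → eval-hom h (ts i)))

  eval-product : {V : Set v} {I : Set ℓ} (A : I → Algebra L) (F : Filter I)
                 {ρ : V → ∀ i → ∣ A i ∣} (t : Term L V) (i : I) →
                 Algebra._≈_ (A i) (eval (reducedProduct A F) ρ t i)
                                   (eval (A i) (λ x → ρ x i) t)
  eval-product A F (var x)    i = Algebra.refl (A i)
  eval-product A F (app g ts) i = Algebra.op-cong (A i) g (λ k → eval-product A F (ts k) i)

  ≅-sym : {A B : Algebra L} → A ≅ B → B ≅ A
  ≅-sym {A} {B} (h , inj , sur) =
    record
      { to   = h⁻¹
      ; cong = λ {x} {y} x≈y → inj (B.trans (hh⁻¹ x) (B.trans x≈y (B.sym (hh⁻¹ y))))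
      ; homo = λ g xs → inj (B.trans (hh⁻¹ _) (B.sym (B.trans (Hom.homo h g _)
                 (B.op-cong g (λ i → hh⁻¹ (xs i))))))
      } ,
    (λ {x} {y} eq → B.trans (B.sym (hh⁻¹ x)) (B.trans (Hom.cong h eq) (hh⁻¹ y))) ,
    λ a → to h a , λ {z} z≈ha → inj (B.trans (hh⁻¹ z) z≈ha)
    where
    module B = Algebra B
    h⁻¹ : ∣ B ∣ → ∣ A ∣
    h⁻¹ b = proj₁ (sur b)
    hh⁻¹ : ∀ b → to h (h⁻¹ b) B.≈ b
    hh⁻¹ b = proj₂ (sur b) (Algebra.refl A)

  image : {A B : Algebra L} → Hom A B → Subuniverse B
  image {A} {B} h = record
    { mem      = λ b → ∃ λ a → to h a B.≈ b
    ; resp     = λ b≈c (a , ha≈b) → a , B.trans ha≈b b≈c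
    ; closed   = λ g ms → Algebra.op A g (proj₁ ∘ ms) ,
                   B.trans (Hom.homo h g _) (B.op-cong g (proj₂ ∘ ms))
    ; nonempty = to h (Algebra.inhabited A) , Algebra.inhabited A , B.refl
    }
    where module B = Algebra B

  embedded : {K : Class L} → IsQuasivariety K →
             ∀ {A B} (h : Hom A B) → IsInjective h → K B → K A
  embedded q {A} {B} h inj b =
    IsQuasivariety.iso q (k , (λ {x} {y} → k-inj {x} {y}) , k-sur) (IsQuasivariety.sub q (image h) b)
    where
    module B = Algebra B
    k : Hom (subalgebra B (image h)) A
    k = record
      { to   = λ (_ , a , _) → a
      ; cong = λ {(_ , _ , p)} {(_ , _ , q)} eq → inj (B.trans p (B.trans eq (B.sym q)))
      ; homo = λ _ _ → Algebra.refl A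
      }
    k-inj : IsInjective k
    k-inj {_ , _ , p} {_ , _ , q} eq = B.trans (B.sym p) (B.trans (Hom.cong h eq) q)
    k-sur : Function.Surjective _ _ (to k)
    k-sur a = (to h a , a , B.refl) , λ {(_ , _ , p)} eq → inj (B.trans p eq)

  -- Mal'cev: a quasivariety contains every model of its implications.
  module Axiomatization (em : ExcludedMiddle (suc ℓ)) {V : Set ℓ} (infinite : ℕ ↣ V)
                        {K : Class L} (q : IsQuasivariety K) (A : Algebra L)
                        (model : ∀ (Φ : Pred (Equation L V) ℓ) e → Φ ⊨[ K ] e →
                                 ∀ ρ → (∀ {d} → Φ d → Satisfies A ρ d) → Satisfies A ρ e)
                        where

    open Algebra A

    private
      dec : (P : Set ℓ) → Dec P
      dec P = map′ lower lift (em {Lift (suc ℓ) P})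

      Covers : (V → Carrier) → List Carrier → Set ℓ
      Covers σ xs = ∀ {x} → x ∈ xs → ∃ λ z → σ z ≈ x

      covering : ∀ xs → ∃ λ σ → Covers σ xs
      covering xs = σ , λ x∈xs → name (index x∈xs) ,
          trans (σ-name (index x∈xs)) (reflexive (≡.sym (lookup-index x∈xs)))
        where
        name : Fin (length xs) → V
        name k = Injection.to infinite (toℕ k)
        Named : V → Set ℓ
        Named z = ∃ λ k → name k ≡ z
        value : ∀ {z} → Dec (Named z) → Carrier
        value (yes (k , _)) = lookup xs k
        value (no _)        = inhabited
        σ : V → Carrier
        σ z = value (dec (Named z))
        value-name : ∀ k (d : Dec (Named (name k))) → value d ≈ lookup xs k
        value-name k (yes (k′ , eq)) =
          reflexive (≡.cong (lookup xs) (toℕ-injective (Injection.injective infinite eq)))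
        value-name k (no ¬named)     = contradiction (k , ≡.refl) ¬named
        σ-name : ∀ k → σ (name k) ≈ lookup xs k
        σ-name k = value-name k (dec _)

      record Interpretation (σ : V → Carrier) : Set (suc ℓ) where
        field
          target : Algebra L
          inK    : K target
          ρ      : V → ∣ target ∣
          sound  : ∀ {d} → Satisfies A σ d → Satisfies target ρ d

      Separates : ∀ {σ} → Interpretation σ → Carrier → Carrier → Set ℓ
      Separates {σ} C x y = ∀ {z z′} → σ z ≈ x → σ z′ ≈ y →
        ¬ Algebra._≈_ target (ρ z) (ρ z′)
        where open Interpretation C

      Separable : (V → Carrier) → Carrier → Carrier → Set (suc ℓ)
      Separable σ x y = Σ[ C ∈ Interpretation σ ] Separates C x y

      trivial : ∀ {σ} → Interpretation σ
      trivial = record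
        { target = reducedProduct none F
        ; inK    = IsQuasivariety.reduced q {A = none} F λ ()
        ; ρ      = λ _ ()
        ; sound  = λ _ → tt
        }
        where
        none : ⊥ → Algebra L
        none ()
        F : Filter ⊥
        F = record { Large = λ _ → ⊤ {ℓ} ; full = tt ; upward = λ _ _ → tt ; meet = λ _ _ → tt }

      choose : ∀ {σ x y} → Dec (Separable σ x y) → Interpretation σ
      choose (yes (C , _)) = C
      choose (no _)        = trivial

      separable : ∀ {σ x y} → Covers σ (x ∷ y ∷ []) → ¬ x ≈ y → Separable σ x y
      separable {σ} {x} {y} cov x≉y = decidable-stable em λ none →
        let z  , σz≈x  = cov (here ≡.refl)
            z′ , σz′≈y = cov (there (here ≡.refl))
        in x≉y (trans (sym σz≈x) (trans
             (model (Satisfies A σ) (var z , var z′)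
               (λ B b ρ sound → decidable-stable (dec _) λ ρz≉ρz′ →
                 let C = record { target = B ; inK = b ; ρ = ρ
                                ; sound = λ {d} → sound {d} }
                 in none (C , λ {u} {u′} σu≈x σu′≈y ρu≈ρu′ → ρz≉ρz′
                      (Algebra.trans B (sound {var z , var u} (trans σz≈x (sym σu≈x)))
                        (Algebra.trans B ρu≈ρu′
                          (sound {var u′ , var z′} (trans σu′≈y (sym σz′≈y)))))))
               σ id)
             σz′≈y))

      J : Set ℓ
      J = (V → Carrier) × Carrier × Carrier

      F : Filter J
      F = record
        { Large  = λ P → ∃ λ xs → ∀ j → Covers (proj₁ j) xs → P j
        ; full   = [] , λ _ _ → tt
        ; upward = λ P⊆Q (xs , p) → xs , λ j cov → P⊆Q (p j cov)
        ; meet   = λ (xs , p) (ys , q) → xs ++ ys , λ j cov →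
            p j (λ m → cov (∈-++⁺ˡ m)) , q j (λ m → cov (∈-++⁺ʳ xs m))
        }

      chosen : (j : J) → Interpretation (proj₁ j)
      chosen (σ , x , y) = choose (em {Separable σ x y})

      module C j = Interpretation (chosen j)

      assign : ∀ j {x} → Dec (∃ λ z → proj₁ j z ≈ x) → ∣ C.target j ∣
      assign j (yes (z , _)) = C.ρ j z
      assign j (no _)        = Algebra.inhabited (C.target j)

      h : ∀ j → Carrier → ∣ C.target j ∣
      h j x = assign j (dec (∃ λ z → proj₁ j z ≈ x))

      h-value : ∀ j {x z} → proj₁ j z ≈ x → Algebra._≈_ (C.target j) (h j x) (C.ρ j z)
      h-value j {x} {z} σz≈x = go (dec _)
        where
        go : (d : Dec (∃ λ z → proj₁ j z ≈ x)) →
             Algebra._≈_ (C.target j) (assign j d) (C.ρ j z)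
        go (yes (z′ , σz′≈x)) = C.sound j {var z′ , var z} (trans σz′≈x (sym σz≈x))
        go (no uncovered)     = contradiction (z , σz≈x) uncovered

      embedding : Hom A (reducedProduct C.target F)
      embedding = record
        { to   = λ x j → h j x
        ; cong = λ {x} {y} x≈y → x ∷ [] , λ j cov →
            let z , σz≈x = cov (here ≡.refl)
            in Algebra.trans (C.target j) (h-value j σz≈x)
                 (Algebra.sym (C.target j) (h-value j (trans σz≈x x≈y)))
        ; homo = λ g xs → op g xs ∷ tabulate xs , λ j cov →
            let open Algebra (C.target j) using () renaming (trans to trans′; sym to sym′; op-cong to op-cong′)
                z , σz≈ = cov (here ≡.refl)
                us i    = cov (there (∈-tabulate⁺ {f = xs} i))
            in trans′ (h-value j σz≈) (trans′
                 (C.sound j {var z , app g (var ∘ proj₁ ∘ us)}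
                   (trans σz≈ (sym (op-cong g (proj₂ ∘ us)))))
                 (sym′ (op-cong′ g (λ i → h-value j (proj₂ (us i))))))
        }

      injective : IsInjective embedding
      injective {x} {y} (xs , eq) = decidable-stable (dec _) λ x≉y →
        let σ , cov = covering (x ∷ y ∷ xs)
            covxy : Covers σ (x ∷ y ∷ [])
            covxy = λ { (here p) → cov (here p) ; (there (here p)) → cov (there (here p)) }
            j = σ , x , y
            z  , σz≈x  = cov (here ≡.refl)
            z′ , σz′≈y = cov (there (here ≡.refl))
            open Algebra (C.target j) using () renaming (trans to trans′; sym to sym′)
        in chosen-separates (separable covxy x≉y) em σz≈x σz′≈y
             (trans′ (sym′ (h-value j σz≈x))
               (trans′ (eq j (λ m → cov (there (there m)))) (h-value j σz′≈y)))
        where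
        chosen-separates : ∀ {σ} → Separable σ x y → (d : Dec (Separable σ x y)) →
                           Separates (choose d) x y
        chosen-separates _ (yes (C , sep)) = sep
        chosen-separates s (no none)       = contradiction s none

    member : K A
    member = embedded q embedding injective (IsQuasivariety.reduced q F C.inK)

record Translation (LX LY : Signature ℓ) : Set ℓ where
  field
    ζ : (g : Op LX) → Term LY (Fin (arity LX g))
    f : Term LY (Fin 1)

  f⟨_⟩ : {W : Set w} → Term LY W → Term LY W
  f⟨ t ⟩ = f [ (λ _ → t) ]

  ζ⁎ : {V : Set v} → Term LX V → Term LY V
  ζ⁎ (var x)    = f⟨ var x ⟩
  ζ⁎ (app g ts) = ζ g [ (λ i → ζ⁎ (ts i)) ]

  ζ⁎-eq : {V : Set v} → Equation LX V → Equation LY V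
  ζ⁎-eq (s , t) = ζ⁎ s , ζ⁎ t

  ζ* : {V : Set v} → Pred (Equation LX V) p → Pred (Equation LY V) _
  ζ* Φ e = ∃ λ d → Φ d × e ≡ ζ⁎-eq d

  -- { f(x) ≈ x : x ∈ W }
  selected : (W : Set w) → Pred (Equation LY W) _
  selected W e = ∃ λ (x : W) → e ≡ (f⟨ var x ⟩ , var x)

  -- Aᶠ
  Fixed : (A : Algebra LY) → Pred ∣ A ∣ ℓ
  Fixed A a = Algebra._≈_ A (eval A (λ _ → a) f) a

module _ {LX LY : Signature ℓ} (X : Quasivariety LX) (Y : Quasivariety LY)
         (T : Translation LX LY) where

  open Translation T

  record IsSelective (V : Set ℓ) : Set (suc ℓ) where
    field
      idempotent : ∅ ⊨[ class Y ] (f⟨ f ⟩ , f)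
      transfer   : ∀ (Φ : Pred (Equation LX V) ℓ) e → Φ ⊨[ class X ] e →
                   (ζ* Φ ∪ selected V) ⊨[ class Y ] ζ⁎-eq e
      preserved  : ∀ g → selected (Fin (arity LX g)) ⊨[ class Y ] (f⟨ ζ g ⟩ , ζ g)

Object : {L : Signature ℓ} → Quasivariety L → Set (suc ℓ)
Object X = Σ (Algebra _) (class X)

-- Excluded middle and the infinitude of V serve only to show that θ takes values in X:
-- `transfer` says that θ A satisfies the implications valid in X, and X is axiomatized
-- by those.
module Selection (em : ExcludedMiddle (suc ℓ))
                 {LX LY : Signature ℓ} {X : Quasivariety LX} {Y : Quasivariety LY}
                 {V : Set ℓ} (infinite : ℕ ↣ V)
                 {T : Translation LX LY} (selective : IsSelective X Y T V) where

  open Translation T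
  open IsSelective selective

  private
    module X = Quasivariety X
    module Y = Quasivariety Y

  fixed-f : (A : Object Y) (a : ∣ proj₁ A ∣) →
            Fixed (proj₁ A) (eval (proj₁ A) (λ _ → a) f)
  fixed-f (A , A∈Y) a =
    trans (sym (eval-subst A f)) (idempotent A A∈Y (λ _ → a) (λ ()))
    where open Algebra A

  θ : Object Y → Algebra LX
  θ (A , A∈Y) = record
    { setoid = record
      { Carrier       = Σ Carrier (Fixed A)
      ; _≈_           = λ x y → proj₁ x ≈ proj₁ y
      ; isEquivalence = record { refl = refl ; sym = sym ; trans = trans }
      }
    ; op        = λ g xs →
        eval A (proj₁ ∘ xs) (ζ g) ,
        trans (sym (eval-subst A f))
          (preserved g A A∈Y (proj₁ ∘ xs) λ { (i , ≡.refl) →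
            trans (eval-subst A f) (proj₂ (xs i)) })
    ; op-cong   = λ g → eval-cong A (ζ g)
    ; inhabited = eval A (λ _ → inhabited) f , fixed-f (A , A∈Y) inhabited
    }
    where open Algebra A

  θ₁ : (A B : Object Y) → Hom (proj₁ A) (proj₁ B) → Hom (θ A) (θ B)
  θ₁ (A , _) (B , _) h = record
    { to   = λ (a , fixed) → to h a , trans (sym (eval-hom h f)) (Hom.cong h fixed)
    ; cong = Hom.cong h
    ; homo = λ g xs → eval-hom h (ζ g)
    }
    where open Algebra B

  eval-θ : {W : Set w} (A : Object Y) (ρ : W → ∣ θ A ∣) (t : Term LX W) →
           Algebra._≈_ (proj₁ A) (eval (proj₁ A) (proj₁ ∘ ρ) (ζ⁎ t))
                                 (proj₁ (eval (θ A) ρ t))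
  eval-θ (A , _)   ρ (var x)    = Algebra.trans A (eval-subst A f) (proj₂ (ρ x))
  eval-θ (A , A∈Y) ρ (app g ts) =
    Algebra.trans A (eval-subst A (ζ g)) (eval-cong A (ζ g) (λ i → eval-θ (A , A∈Y) ρ (ts i)))

  θ∈X : ∀ A → class X (θ A)
  θ∈X (A , A∈Y) = Axiomatization.member em infinite X.isQuasivariety (θ 𝔸)
    λ Φ (s , t) Φ⊨e ρ sat →
      trans (sym (eval-θ 𝔸 ρ s)) (trans
        (transfer Φ (s , t) Φ⊨e A A∈Y (proj₁ ∘ ρ)
          λ { (inj₁ ((s′ , t′) , d∈Φ , ≡.refl)) →
                trans (eval-θ 𝔸 ρ s′) (trans (sat d∈Φ) (sym (eval-θ 𝔸 ρ t′)))
            ; (inj₂ (x , ≡.refl)) → trans (eval-subst A f) (proj₂ (ρ x)) })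
        (eval-θ 𝔸 ρ t))
    where
    open Algebra A
    𝔸 : Object Y
    𝔸 = A , A∈Y

  θₒ : Object Y → Object X
  θₒ A = θ A , θ∈X A

  -- A left adjoint of θ, presented by unit, counit and the triangle identities; it is
  -- unique up to natural isomorphism.
  record LeftAdjoint : Set (suc ℓ) where
    field
      F₀           : Object X → Object Y
      F₁           : ∀ A B → Hom (proj₁ A) (proj₁ B) → Hom (proj₁ (F₀ A)) (proj₁ (F₀ B))
      F-resp       : ∀ A B {h k : Hom (proj₁ A) (proj₁ B)} → h ≗ₕ k → F₁ A B h ≗ₕ F₁ A B k
      identity     : ∀ A → F₁ A A (idHom (proj₁ A)) ≗ₕ idHom (proj₁ (F₀ A))
      homomorphism : ∀ A B C (h : Hom (proj₁ A) (proj₁ B)) (k : Hom (proj₁ B) (proj₁ C)) →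
                     F₁ A C (k ∘ₕ h) ≗ₕ F₁ B C k ∘ₕ F₁ A B h
      η            : ∀ A → Hom (proj₁ A) (θ (F₀ A))
      η-natural    : ∀ A B (h : Hom (proj₁ A) (proj₁ B)) →
                     η B ∘ₕ h ≗ₕ θ₁ (F₀ A) (F₀ B) (F₁ A B h) ∘ₕ η A
      ε            : ∀ B → Hom (proj₁ (F₀ (θₒ B))) (proj₁ B)
      ε-natural    : ∀ A B (h : Hom (proj₁ A) (proj₁ B)) →
                     h ∘ₕ ε A ≗ₕ ε B ∘ₕ F₁ (θₒ A) (θₒ B) (θ₁ A B h)
      zig          : ∀ A → ε (F₀ A) ∘ₕ F₁ A (θₒ (F₀ A)) (η A) ≗ₕ idHom (proj₁ (F₀ A))
      zag          : ∀ B → θ₁ (F₀ (θₒ B)) B (ε B) ∘ₕ η (θₒ B) ≗ₕ idHom (θ B)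

  IsStronglySelective : LeftAdjoint → Set (suc ℓ)
  IsStronglySelective 𝓕 = ∀ A → IsIso (LeftAdjoint.η 𝓕 A)

  record IsSober (𝓕 : LeftAdjoint) : Set (suc ℓ) where
    open LeftAdjoint 𝓕
    field
      stronglySelective : IsStronglySelective 𝓕
      ε-injective       : ∀ B → IsInjective (ε B)
      F-injective       : ∀ A B (h : Hom (proj₁ A) (proj₁ B)) →
                          IsInjective h → IsInjective (F₁ A B h)

  -- Bᶠ, a subset of B, is compared with Aᶠ as a subset of A.
  infix 4 _≼_
  data _≼_ : Algebra LY → Algebra LY → Set (suc ℓ) where
    subᶠ : ∀ {A} (S : Subuniverse A) →
           (λ a → Σ[ s ∈ mem S a ] Fixed (subalgebra A S) (a , s)) ≐ Fixed A →
           subalgebra A S ≼ A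

  infix 9 _↑
  _↑ : Class LY → Class LY
  (K ↑) A = class Y A × ∃ λ B → K B × B ≼ A

  IsFQuasivariety : Class LY → Set (suc (suc ℓ))
  IsFQuasivariety C = ∃ λ (K : Subquasivariety Y) → C ≐ ⟨ K ⟩ ↑

  record FQuasivariety : Set (suc (suc ℓ)) where
    field
      fclass    : Class LY
      witnessed : IsFQuasivariety fclass

  open FQuasivariety public

  τ-class : Subquasivariety X → Class LY
  τ-class K A = Σ[ A∈Y ∈ class Y A ] ⟨ K ⟩ (θ (A , A∈Y))

  τ : (∀ K → IsFQuasivariety (τ-class K)) → Subquasivariety X → FQuasivariety
  τ τ∈Ξᶠ K = record { fclass = τ-class K ; witnessed = τ∈Ξᶠ K }

  private
    witness : FQuasivariety → Subquasivariety Y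
    witness P = proj₁ (witnessed P)

  ≼-intro : ∀ {A} (S : Subuniverse A) → Fixed A ⊆ mem S → subalgebra A S ≼ A
  ≼-intro {A} S fix = subᶠ S
    ( (λ (s , fs) → trans (sym (eval-hom (inclusion A S) f)) fs)
    , (λ fa → fix fa , trans (eval-hom (inclusion A S) f) fa))
    where open Algebra A

  ≼-elim : ∀ {A B} → B ≼ A →
           Σ[ S ∈ Subuniverse A ] Fixed A ⊆ mem S × B ≡ subalgebra A S
  ≼-elim (subᶠ S (_ , fix)) = S , (λ fa → proj₁ (fix fa)) , ≡.refl

  ↑-intro : ∀ {A} {K : Class LY} → class Y A →
            (S : Subuniverse A) → Fixed A ⊆ mem S → K (subalgebra A S) → (K ↑) A
  ↑-intro A∈Y S fix s = A∈Y , _ , s , ≼-intro S fix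

  ↑-elim : ∀ {A} {K : Class LY} → (K ↑) A →
           Σ[ S ∈ Subuniverse A ] Fixed A ⊆ mem S × K (subalgebra A S)
  ↑-elim (_ , _ , b , B≼A) with ≼-elim B≼A
  ... | S , fix , ≡.refl = S , (λ {a} → fix {a}) , b

  ↑-mono : {K M : Class LY} → K ⊆ M → K ↑ ⊆ M ↑
  ↑-mono K⊆M (y , B , b , B≼A) = y , B , K⊆M b , B≼A

  fixed-hom : ∀ {A B : Algebra LY} (h : Hom A B) {a} → Fixed A a → Fixed B (to h a)
  fixed-hom {B = B} h fa = Algebra.trans B (Algebra.sym B (eval-hom h f)) (Hom.cong h fa)

  module _ (K : Subquasivariety Y) where

    private module K = Subquasivariety K

    ⊆↑ : ⟨ K ⟩ ⊆ ⟨ K ⟩ ↑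
    ⊆↑ {A} a = ↑-intro (K.below a) S _ (embedded K.isQuasivariety (inclusion A S) id a)
      where
      S : Subuniverse A
      S = record { mem = λ _ → ⊤ ; resp = λ _ _ → tt ; closed = λ _ _ → tt
                 ; nonempty = Algebra.inhabited A , tt }

    ↑↑⊆↑ : ⟨ K ⟩ ↑ ↑ ⊆ ⟨ K ⟩ ↑
    ↑↑⊆↑ {A} a↑↑ with ↑-elim a↑↑
    ... | S , fix , s↑ with ↑-elim s↑
    ... | R , fix′ , r = ↑-intro (proj₁ a↑↑) R′
        (λ {a} fa → fix fa ,
          fix′ {a , fix fa} (trans (eval-hom (inclusion A S) f) fa))
        (embedded K.isQuasivariety
          {subalgebra A R′} {subalgebra (subalgebra A S) R}
          (record { to = λ (a , s , m) → (a , s) , m ; cong = id ; homo = λ _ _ → refl })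
          id r)
      where
      open Algebra A
      R′ : Subuniverse A
      R′ = record
        { mem      = λ a → Σ (mem S a) λ s → mem R (a , s)
        ; resp     = λ x≈y (s , m) → Subuniverse.resp S x≈y s , Subuniverse.resp R x≈y m
        ; closed   = λ g ms → _ , Subuniverse.closed R g (proj₂ ∘ ms)
        ; nonempty = let (a , s) , m = Subuniverse.nonempty R in a , s , m
        }

    ↑-embedded : ∀ {A B} (h : Hom A B) → IsInjective h → (⟨ K ⟩ ↑) B → (⟨ K ⟩ ↑) A
    ↑-embedded {A} {B} h inj b↑ with ↑-elim b↑
    ... | S , fix , s = ↑-intro A∈Y S′ (λ fa → fix (fixed-hom h fa))
        (embedded K.isQuasivariety {subalgebra A S′} {subalgebra B S}
          (record { to = λ (a , m) → to h a , m ; cong = Hom.cong h ; homo = λ g _ → Hom.homo h g _ })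
          inj s)
      where
      A∈Y : class Y A
      A∈Y = embedded Y.isQuasivariety h inj (proj₁ b↑)
      S′ : Subuniverse A
      S′ = record
        { mem      = mem S ∘ to h
        ; resp     = λ x≈y → Subuniverse.resp S (Hom.cong h x≈y)
        ; closed   = λ g ms → Subuniverse.resp S (Algebra.sym B (Hom.homo h g _))
                                (Subuniverse.closed S g ms)
        ; nonempty = _ , fix (fixed-hom h (fixed-f (A , A∈Y) (Algebra.inhabited A)))
        }

    ↑-reduced : ∀ {I : Set ℓ} {A : I → Algebra LY} (F : Filter I) →
                (∀ i → (⟨ K ⟩ ↑) (A i)) → (⟨ K ⟩ ↑) (reducedProduct A F)
    ↑-reduced {I} {A} F as = ↑-intro (Y.reduced F (proj₁ ∘ as)) R
        (λ {a} fa →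
          (λ i → eval (A i) (λ _ → a i) f , fix i (fixed-f (A i , proj₁ (as i)) (a i))) ,
          upward (λ {i} eq → A.trans i (A.sym i (eval-product A F f i)) eq) fa)
        (embedded K.isQuasivariety
          {subalgebra (reducedProduct A F) R}
          {reducedProduct (λ i → subalgebra (A i) (S i)) F}
          (record
            { to   = λ (_ , s , _) → s
            ; cong = λ {(_ , _ , p)} {(_ , _ , q)} a≈b →
                upward (λ {i} ((p , q) , r) → A.trans i p (A.trans i r (A.sym i q)))
                  (meet (meet p q) a≈b)
            ; homo = λ _ _ → always λ i → A.refl i
            })
          (λ {(_ , _ , p)} {(_ , _ , q)} s≈t →
            upward (λ {i} ((p , q) , r) → A.trans i (A.sym i p) (A.trans i r q))
              (meet (meet p q) s≈t))
          (K.reduced F (λ i → proj₂ (proj₂ (↑-elim (as i))))))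
      where
      open Filter F
      module A i = Algebra (A i)
      S : ∀ i → Subuniverse (A i)
      S i = proj₁ (↑-elim (as i))
      fix : ∀ i → Fixed (A i) ⊆ mem (S i)
      fix i = proj₁ (proj₂ (↑-elim (as i)))
      R : Subuniverse (reducedProduct A F)
      R = record
        { mem      = λ a → Σ[ s ∈ (∀ i → Σ _ (mem (S i))) ]
                       Large (λ i → A._≈_ i (proj₁ (s i)) (a i))
        ; resp     = λ a≈b (s , p) → s ,
            upward (λ {i} (x , y) → A.trans i x y) (meet p a≈b)
        ; closed   = λ g ms →
            (λ i → _ , Subuniverse.closed (S i) g (λ k → proj₂ (proj₁ (ms k) i))) ,
            upward (λ {i} → A.op-cong i g) (meets (arity LY g) (proj₂ ∘ ms))
        ; nonempty = let s = λ i → Subuniverse.nonempty (S i) in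
            proj₁ ∘ s , s , always λ i → A.refl i
        }

    ↑-isQuasivariety : IsQuasivariety (⟨ K ⟩ ↑)
    ↑-isQuasivariety = record
      { iso     = λ i a → let h , inj , _ = ≅-sym i in ↑-embedded h inj a
      ; sub     = λ S a → ↑-embedded (inclusion _ S) id a
      ; reduced = ↑-reduced
      }

  ↑-∩ : (K M : Subquasivariety Y) → (⟨ K ⟩ ↑ ∩ ⟨ M ⟩ ↑) ⊆ (⟨ K ⟩ ∩ ⟨ M ⟩) ↑
  ↑-∩ K M {A} (k↑ , m↑) with ↑-elim k↑ | ↑-elim m↑
  ... | S , fixS , k | R , fixR , m =
      ↑-intro {K = ⟨ K ⟩ ∩ ⟨ M ⟩} (proj₁ k↑) S∩R (λ fa → fixS fa , fixR fa)
        ( embedded (Subquasivariety.isQuasivariety K) {subalgebra A S∩R} {subalgebra A S}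
            (record { to = λ (a , s , _) → a , s ; cong = id ; homo = λ _ _ → refl }) id k
        , embedded (Subquasivariety.isQuasivariety M) {subalgebra A S∩R} {subalgebra A R}
            (record { to = λ (a , _ , r) → a , r ; cong = id ; homo = λ _ _ → refl }) id m)
    where
    open Algebra A
    S∩R : Subuniverse A
    S∩R = record
      { mem      = mem S ∩ mem R
      ; resp     = λ x≈y (s , r) → Subuniverse.resp S x≈y s , Subuniverse.resp R x≈y r
      ; closed   = λ g ms → Subuniverse.closed S g (proj₁ ∘ ms) ,
                            Subuniverse.closed R g (proj₂ ∘ ms)
      ; nonempty = let fa = fixed-f (A , proj₁ k↑) inhabited in _ , fixS fa , fixR fa
      }

  infixr 7 _∧Ξᶠ_
  infixr 6 _∨Ξᶠ_

  _∧Ξᶠ_ _∨Ξᶠ_ : FQuasivariety → FQuasivariety → FQuasivariety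
  P ∧Ξᶠ Q = record
    { fclass    = fclass P ∩ fclass Q
    ; witnessed = _∧Ξ_ Y (witness P) (witness Q) ,
        (λ (p , q) → ↑-∩ (witness P) (witness Q)
          (proj₁ (proj₂ (witnessed P)) p , proj₁ (proj₂ (witnessed Q)) q)) ,
        (λ m → proj₂ (proj₂ (witnessed P)) (↑-mono {⟨ witness P ⟩ ∩ ⟨ witness Q ⟩} proj₁ m) ,
               proj₂ (proj₂ (witnessed Q)) (↑-mono {⟨ witness P ⟩ ∩ ⟨ witness Q ⟩} proj₂ m))
    }
  P ∨Ξᶠ Q = record
    { fclass    = ⟨ J ⟩ ↑
    ; witnessed = J , id , id
    }
    where
    J : Subquasivariety Y
    J = _∨Ξ_ Y (witness P) (witness Q)

  Ξᶠ : Lattice (suc (suc ℓ)) (suc ℓ) (suc ℓ)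
  Ξᶠ = inclusionLattice fclass _∨Ξᶠ_ _∧Ξᶠ_
    (λ P Q →
      (λ p → ↑-mono {⟨ witness P ⟩} (λ a → gen (inj₁ a)) (proj₁ (proj₂ (witnessed P)) p)) ,
      (λ q → ↑-mono {⟨ witness Q ⟩} (λ a → gen (inj₂ a)) (proj₁ (proj₂ (witnessed Q)) q)) ,
      λ R P⊆R Q⊆R j →
        let M , R⊆M↑ , M↑⊆R = witnessed R in
        M↑⊆R (↑↑⊆↑ M (↑-mono {_} {⟨ M ⟩ ↑}
          (generated-least (↑-isQuasivariety M)
            λ { (inj₁ a) → R⊆M↑ (P⊆R (proj₂ (proj₂ (witnessed P)) (⊆↑ (witness P) a)))
              ; (inj₂ a) → R⊆M↑ (Q⊆R (proj₂ (proj₂ (witnessed Q)) (⊆↑ (witness Q) a))) }) j)))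
    (λ P Q → id , id)

rawLattice : ∀ {a b c} → Lattice a b c → RawLattice a b
rawLattice L = Alg.Lattice.rawLattice (LatticeProperties.algLattice L)

{-# OPTIONS --safe #-}
module Submission where

-- Both lattices are ordered by inclusion, and an order isomorphism of lattices is a
-- lattice isomorphism; τ is clearly monotone, so it is enough that it takes values in
-- Ξᶠ(Y), reflects inclusion and is surjective.
--
-- Values in Ξᶠ(Y).  The functor θ preserves embeddings and commutes with reduced products,
-- so τ(K) is a quasivariety.  If B is a subalgebra of A with the same selected elements,
-- then θ(A) embeds into θ(B), so τ(K) is its own upward closure (τ-↑-fixed).
--
-- Reflecting inclusion.  The unit gives A ≅ θ(𝓕(A)), so A belongs to K exactly when 𝓕(A)
-- belongs to τ(K): the class τ(K) determines K (τ-reflects).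
--
-- Surjectivity.  For a subquasivariety M of Y, the class K of all algebras embeddable
-- into some θ(B) with B in M is a subquasivariety of X, and τ(K) = M↑ (τ-θembeddable).
-- If A is in M↑ through B, then θ(A) embeds into θ(B).  Conversely, an embedding of
-- θ(A) into θ(B) with B in M yields 𝓕θ(A) ↪ 𝓕θ(B) ↪ B, where the first step is
-- preservation of embeddings by 𝓕 and the second is the counit; so 𝓕θ(A) is in M.
-- The counit also identifies 𝓕θ(A) with a subalgebra of A, and a triangle identity shows
-- that this subalgebra contains every selected element.  Hence A is in M↑.

open import Defs
open import Level using (Level; suc)
open import Data.Nat using (ℕ)
open import Data.Product using (Σ-syntax; _,_; proj₁; proj₂)
open import Function using (_↣_; _∘_; id)
open import Relation.Binary.Lattice using (Lattice)
open import Relation.Unary using (_⊆_; _≐_)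
open import Axiom.ExcludedMiddle using (ExcludedMiddle)
open import Algebra.Lattice.Morphism.Structures using (IsLatticeIsomorphism)

-- Order isomorphisms of lattices

-- Meets and joins are determined by the order: surjectivity provides a preimage z of
-- φ x ∨ φ y, reflection of the order makes z an upper bound of x and y, so x ∨ y ≤ z and
-- φ (x ∨ y) ≤ φ x ∨ φ y.  Dually for meets.
module _ {a₁ b₁ c₁ a₂ b₂ c₂} (L : Lattice a₁ b₁ c₁) (M : Lattice a₂ b₂ c₂) where

  private
    module L = Lattice L
    module M = Lattice M

  orderIsomorphism⇒latticeIsomorphism :
    (φ : L.Carrier → M.Carrier) →
    (∀ x y → x L.≤ y → φ x M.≤ φ y) →
    (∀ x y → φ x M.≤ φ y → x L.≤ y) →
    (∀ y → Σ[ x ∈ L.Carrier ] φ x M.≈ y) →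
    IsLatticeIsomorphism (rawLattice L) (rawLattice M) φ
  orderIsomorphism⇒latticeIsomorphism φ mono reflects preimage = record
    { isLatticeMonomorphism = record
      { isLatticeHomomorphism = record
        { isRelHomomorphism = record { cong = φ-cong }
        ; ∧-homo            = ∧-homo
        ; ∨-homo            = ∨-homo
        }
      ; injective = λ {x} {y} φx≈φy → L.antisym
          (reflects x y (M.reflexive φx≈φy))
          (reflects y x (M.reflexive (M.Eq.sym φx≈φy)))
      }
    ; surjective = λ y → let x , φx≈y = preimage y in
        x , λ z≈x → M.Eq.trans (φ-cong z≈x) φx≈y
    }
    where
    φ-cong : ∀ {x y} → x L.≈ y → φ x M.≈ φ y
    φ-cong x≈y = M.antisym (mono _ _ (L.reflexive x≈y))
                           (mono _ _ (L.reflexive (L.Eq.sym x≈y)))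

    ∧-homo : ∀ x y → φ (x L.∧ y) M.≈ (φ x M.∧ φ y)
    ∧-homo x y = M.antisym
      (M.∧-greatest (mono _ _ (L.x∧y≤x x y)) (mono _ _ (L.x∧y≤y x y)))
      (M.trans (M.reflexive (M.Eq.sym φz≈))
        (mono z _ (L.∧-greatest
          (reflects z x (M.trans (M.reflexive φz≈) (M.x∧y≤x _ _)))
          (reflects z y (M.trans (M.reflexive φz≈) (M.x∧y≤y _ _))))))
      where
      z = proj₁ (preimage (φ x M.∧ φ y))
      φz≈ : φ z M.≈ (φ x M.∧ φ y)
      φz≈ = proj₂ (preimage (φ x M.∧ φ y))

    ∨-homo : ∀ x y → φ (x L.∨ y) M.≈ (φ x M.∨ φ y)
    ∨-homo x y = M.antisym
      (M.trans
        (mono _ z (L.∨-least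
          (reflects x z (M.trans (M.x≤x∨y _ _) (M.reflexive (M.Eq.sym φz≈))))
          (reflects y z (M.trans (M.y≤x∨y _ _) (M.reflexive (M.Eq.sym φz≈))))))
        (M.reflexive φz≈))
      (M.∨-least (mono _ _ (L.x≤x∨y x y)) (mono _ _ (L.y≤x∨y x y)))
      where
      z = proj₁ (preimage (φ x M.∨ φ y))
      φz≈ : φ z M.≈ (φ x M.∨ φ y)
      φz≈ = proj₂ (preimage (φ x M.∨ φ y))

-- Embeddings

module _ {ℓ : Level} {L : Signature ℓ} where

  infix 4 _↪_
  _↪_ : Algebra L → Algebra L → Set ℓ
  A ↪ B = Σ[ h ∈ Hom A B ] IsInjective h

  ↪-trans : ∀ {A B C : Algebra L} → A ↪ B → B ↪ C → A ↪ C
  ↪-trans (h , h-inj) (k , k-inj) = k ∘ₕ h , h-inj ∘ k-inj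

  ≅⇒↪ : ∀ {A B : Algebra L} → A ≅ B → A ↪ B
  ≅⇒↪ (h , inj , _) = h , inj

  ↪-closed : {K : Class L} → IsQuasivariety K → ∀ {A B} → A ↪ B → K B → K A
  ↪-closed q (h , inj) = embedded q h inj

  image↪domain : ∀ {A B : Algebra L} (h : Hom A B) → IsInjective h →
                 subalgebra B (image h) ↪ A
  image↪domain {A} {B} h inj =
    record
      { to   = λ (_ , a , _) → a
      ; cong = λ {(_ , _ , p)} {(_ , _ , q)} b≈c → inj (trans p (trans b≈c (sym q)))
      ; homo = λ _ _ → Algebra.refl A
      } ,
    λ {(_ , _ , p)} {(_ , _ , q)} a≈b → trans (sym p) (trans (Hom.cong h a≈b) q)
    where open Algebra B

  reducedProduct-↪ : ∀ {I : Set ℓ} {A B : I → Algebra L} (F : Filter I) →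
                     (∀ i → A i ↪ B i) → reducedProduct A F ↪ reducedProduct B F
  reducedProduct-↪ {B = B} F e =
    record
      { to   = λ a i → to (proj₁ (e i)) (a i)
      ; cong = upward (λ {i} → Hom.cong (proj₁ (e i)))
      ; homo = λ g xs → always λ i → Hom.homo (proj₁ (e i)) g (λ k → xs k i)
      } ,
    upward (λ {i} → proj₂ (e i))
    where open Filter F

module _ {ℓ : Level} (em : ExcludedMiddle (suc ℓ))
         {LX LY : Signature ℓ} (X : Quasivariety LX) (Y : Quasivariety LY)
         {V : Set ℓ} (infinite : ℕ ↣ V)
         (T : Translation LX LY) (selective : IsSelective X Y T V) where

  open Translation T
  open Selection em {X = X} {Y = Y} infinite {T = T} selective

  private
    module X = Quasivariety X
    module Y = Quasivariety Y

  -- Preservation properties of θ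

  θ-↪ : (A B : Object Y) → proj₁ A ↪ proj₁ B → θ A ↪ θ B
  θ-↪ A B (h , inj) = θ₁ A B h , inj

  -- A proof of membership in Y enters θ only through the closure of the selected elements
  -- under the operations, so replacing it changes neither the elements nor their values.
  θ-id : ∀ {A} (p q : class Y A) → θ (A , p) ↪ θ (A , q)
  θ-id {A} p q = θ-↪ (A , p) (A , q) (idHom A , id)

  θ-subalgebra : ∀ {A} (A∈Y : class Y A) (S : Subuniverse A) (S∈Y : class Y (subalgebra A S)) →
                 Fixed A ⊆ mem S → θ (A , A∈Y) ↪ θ (subalgebra A S , S∈Y)
  θ-subalgebra {A} A∈Y S S∈Y fix =
    record
      { to   = λ (a , fa) → (a , fix fa) , trans (eval-hom (inclusion A S) f) fa
      ; cong = id
      ; homo = λ g _ → sym (eval-hom (inclusion A S) (ζ g))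
      } ,
    id
    where open Algebra A

  -- A selected element of a reduced product is selected only on a large set of
  -- coordinates; applying f to every coordinate gives an equal element that is selected
  -- on all of them, and this is why the map is onto.
  θ-reducedProduct :
    ∀ {I : Set ℓ} {B : I → Algebra LY} (F : Filter I) (B∈Y : ∀ i → class Y (B i)) →
    reducedProduct (λ i → θ (B i , B∈Y i)) F ≅ θ (reducedProduct B F , Y.reduced F B∈Y)
  θ-reducedProduct {I} {B} F B∈Y =
    record
      { to   = λ b → proj₁ ∘ b ,
                 always λ i → B.trans i (eval-product B F f i) (proj₂ (b i))
      ; cong = id
      ; homo = λ g _ → always λ i → B.sym i (eval-product B F (ζ g) i)
      } ,
    id ,
    λ (a , fa) →
      (λ i → eval (B i) (λ _ → a i) f , fixed-f (B i , B∈Y i) (a i)) ,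
      λ z≈fa → upward (λ {i} (p , q) →
        B.trans i p (B.trans i (B.sym i (eval-product B F f i)) q)) (meet z≈fa fa)
    where
    open Filter F
    module B i = Algebra (B i)

  -- The classes τ(K)

  module _ (K : Subquasivariety X) where

    private module K = Subquasivariety K

    τ-↪-closed : ∀ {A B} → A ↪ B → τ-class K B → τ-class K A
    τ-↪-closed {A} {B} e (B∈Y , θB∈K) =
      A∈Y , ↪-closed K.isQuasivariety (θ-↪ (A , A∈Y) (B , B∈Y) e) θB∈K
      where
      A∈Y : class Y A
      A∈Y = ↪-closed Y.isQuasivariety e B∈Y

    τ-subquasivariety : Subquasivariety Y
    τ-subquasivariety = record
      { quasivariety = record
        { class          = τ-class K
        ; isQuasivariety = record
          { iso     = λ i → τ-↪-closed (≅⇒↪ (≅-sym i))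
          ; sub     = λ S → τ-↪-closed (inclusion _ S , id)
          ; reduced = λ F as → Y.reduced F (proj₁ ∘ as) ,
              K.iso (θ-reducedProduct F (proj₁ ∘ as)) (K.reduced F (proj₂ ∘ as))
          }
        }
      ; below = proj₁
      }

    τ-↑-fixed : τ-class K ≐ τ-class K ↑
    τ-↑-fixed = ⊆↑ τ-subquasivariety , λ a↑ →
      let S , fix , S∈Y , θS∈K = ↑-elim a↑ in
      proj₁ a↑ , ↪-closed K.isQuasivariety (θ-subalgebra (proj₁ a↑) S S∈Y fix) θS∈K

  τ-isFQuasivariety : ∀ K → IsFQuasivariety (τ-class K)
  τ-isFQuasivariety K = τ-subquasivariety K , τ-↑-fixed K

  τ-monotone : ∀ K M → ⟨ K ⟩ ⊆ ⟨ M ⟩ → τ-class K ⊆ τ-class M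
  τ-monotone K M K⊆M (A∈Y , θA∈K) = A∈Y , K⊆M θA∈K

  -- Algebras embeddable into the image of a subquasivariety of Y

  module _ (M : Subquasivariety Y) where

    private module M = Subquasivariety M

    θEmbeddable : Class LX
    θEmbeddable A = Σ[ B ∈ Algebra LY ] Σ[ B∈M ∈ ⟨ M ⟩ B ] A ↪ θ (B , M.below B∈M)

    θEmbeddable-↪-closed : ∀ {A A′} → A ↪ A′ → θEmbeddable A′ → θEmbeddable A
    θEmbeddable-↪-closed e (B , B∈M , e′) = B , B∈M , ↪-trans e e′

    θEmbeddable-subquasivariety : Subquasivariety X
    θEmbeddable-subquasivariety = record
      { quasivariety = record
        { class          = θEmbeddable
        ; isQuasivariety = record
          { iso     = λ i → θEmbeddable-↪-closed (≅⇒↪ (≅-sym i))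
          ; sub     = λ S → θEmbeddable-↪-closed (inclusion _ S , id)
          ; reduced = λ F as →
              let B∈M = λ i → proj₁ (proj₂ (as i)) in
              _ , M.reduced F B∈M ,
              ↪-trans (reducedProduct-↪ F (λ i → proj₂ (proj₂ (as i))))
                (↪-trans (≅⇒↪ (θ-reducedProduct F (λ i → M.below (B∈M i))))
                  (θ-id _ _))
          }
        }
      ; below = λ (_ , _ , e) → ↪-closed X.isQuasivariety e (θ∈X _)
      }

  -- Consequences of sobriety

  module _ (𝓕 : LeftAdjoint) (sober : IsSober 𝓕) where

    open LeftAdjoint 𝓕
    open IsSober sober

    τ-reflects : ∀ K M → τ-class K ⊆ τ-class M → ⟨ K ⟩ ⊆ ⟨ M ⟩
    τ-reflects K M τK⊆τM {A} A∈K =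
      ↪-closed M.isQuasivariety (↪-trans (≅⇒↪ A≅θFA) (θ-id _ _)) (proj₂ FA∈τM)
      where
      module K = Subquasivariety K
      module M = Subquasivariety M
      𝔸 : Object X
      𝔸 = A , K.below A∈K
      A≅θFA : A ≅ θ (F₀ 𝔸)
      A≅θFA = η 𝔸 , stronglySelective 𝔸
      FA∈τM : τ-class M (proj₁ (F₀ 𝔸))
      FA∈τM = τK⊆τM (proj₂ (F₀ 𝔸) , K.iso A≅θFA A∈K)

    fixed⊆image-ε : (A : Object Y) → Fixed (proj₁ A) ⊆ mem (image (ε A))
    fixed⊆image-ε A fa = proj₁ (to (η (θₒ A)) (_ , fa)) , zag A (_ , fa)

    -- The transpose of an embedding into θ(B) is again an embedding, because 𝓕
    -- preserves embeddings and the counit is one.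
    transpose-↪ : (A : Object X) (B : Object Y) → proj₁ A ↪ θ B → proj₁ (F₀ A) ↪ proj₁ B
    transpose-↪ A B (h , inj) =
      ↪-trans (F₁ A (θₒ B) h , F-injective A (θₒ B) h inj) (ε B , ε-injective B)

    τ-θembeddable : (M : Subquasivariety Y) →
                    τ-class (θEmbeddable-subquasivariety M) ≐ ⟨ M ⟩ ↑
    τ-θembeddable M = to↑ , from↑
      where
      module M = Subquasivariety M

      to↑ : τ-class (θEmbeddable-subquasivariety M) ⊆ ⟨ M ⟩ ↑
      to↑ {A} (A∈Y , B , B∈M , e) =
        ↑-intro A∈Y (image (ε 𝔸)) (fixed⊆image-ε 𝔸)
          (↪-closed M.isQuasivariety
            (↪-trans (image↪domain (ε 𝔸) (ε-injective 𝔸))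
                     (transpose-↪ (θₒ 𝔸) (B , M.below B∈M) e))
            B∈M)
        where
        𝔸 : Object Y
        𝔸 = A , A∈Y

      from↑ : ⟨ M ⟩ ↑ ⊆ τ-class (θEmbeddable-subquasivariety M)
      from↑ {A} a↑ =
        let S , fix , S∈M = ↑-elim a↑ in
        proj₁ a↑ , subalgebra A S , S∈M , θ-subalgebra (proj₁ a↑) S (M.below S∈M) fix

    τ-surjective : (P : FQuasivariety) →
                   Σ[ K ∈ Subquasivariety X ] τ-class K ≐ fclass P
    τ-surjective P =
      let M , P⊆M↑ , M↑⊆P = witnessed P
          τ⊆ , ↑⊆         = τ-θembeddable M
      in θEmbeddable-subquasivariety M , (λ a → M↑⊆P (τ⊆ a)) , (λ a → ↑⊆ (P⊆M↑ a))

proposition6p14 : ∀ {ℓ : Level} (em : ExcludedMiddle (suc ℓ))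
    {LX LY : Signature ℓ} (X : Quasivariety LX) (Y : Quasivariety LY)
    {V : Set ℓ} (infinite : ℕ ↣ V)
    (T : Translation LX LY) (selective : IsSelective X Y T V) →
    let open Selection em {X = X} {Y = Y} infinite {T = T} selective in
    (𝓕 : LeftAdjoint) → IsSober 𝓕 →
    Σ[ τ∈Ξᶠ ∈ (∀ K → IsFQuasivariety (τ-class K)) ]
    IsLatticeIsomorphism (rawLattice (Ξ X)) (rawLattice Ξᶠ) (τ τ∈Ξᶠ)
proposition6p14 em X Y infinite T selective 𝓕 sober =
  τ-isFQuasivariety em X Y infinite T selective ,
  orderIsomorphism⇒latticeIsomorphism (Ξ X) Ξᶠ (τ (τ-isFQuasivariety em X Y infinite T selective))
    (τ-monotone em X Y infinite T selective)
    (τ-reflects em X Y infinite T selective 𝓕 sober)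
    (τ-surjective em X Y infinite T selective 𝓕 sober)
  where open Selection em {X = X} {Y = Y} infinite {T = T} selective
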